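{- There is a constant $c>0$ such that the worst-case time complexity of EnumPlus, run on sets $A=\{a_1>a_2>\dots>a_n\}$ of $n$ positive integers with sum $S$ and target value $E=S/2$, is $O(n\cdot 2^{n/2}-c\cdot 2^{n/2}+n)$.
   Context: The subset sum problem (SSP): given positive integers $a_1>a_2>\dots>a_n$ (the set $A$) and a target $E$, find a subset of $A$ with sum $E$. Notation: $A_k=A[k..n]=\{a_k,\dots,a_n\}$, $S_k=\sum_{j=k}^n a_j$ (so $S_{n+1}=0$), $S=S_1$. A block bound of a set of integers is a pair $[b_{MAX},b_{MIN}]$; for a capacity $v$ and the set $A_k$ the algorithm computes a pair with $b_{MAX}\le v\le b_{MIN}$, intended to be the largest subset sum of $A_k$ that is $\le v$ and the smallest that is $\ge v$. Algorithm EnumPlus$(A,E)$: keep, for each $k$, an initially empty collection $V[k]$ of block bounds, and call SetSum$(1,E)$. The recursive procedure SetSum$(k,v)$ does the following. (1) If $v\ge S_k$, return $[S_k,S]$. (2) If $v\le 0$, return $[-a_{k-1},0]$. (3) Query $V[k]$ for a block bound with $b_{MAX}\le v\le b_{MIN}$. If one exists: if $v=b_{MAX}$ or $v=b_{MIN}$, a solution is identified and the algorithm halts; otherwise return that block bound. (4) Otherwise, compute $[b_3,b_4]=$ SetSum$(k+1,v)$ (branch $x_k=0$) and $[b_1,b_2]=$ SetSum$(k+1,v-a_k)$ with $a_k$ added to both entries (branch $x_k=1$). The branch $x_k=0$ is computed first if $|S_k/2-(v-a_k)|>|S_k/2-v|$; otherwise the branch $x_k=1$ is computed first. (5) Put $b_{MAX}=\max\{b_1,b_3\}$,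 $b_{MIN}=\min\{b_2,b_4\}$, insert $[b_{MAX},b_{MIN}]$ into $V[k]$, and return it. The enumeration terminates when a feasible solution is found or when it has backtracked to the root call. Each collection $V[k]$ is implemented as a balanced search tree (e.g. AVL or red-black), so that a query or insertion in a collection of $N$ block bounds has worst-case cost $\log N$ (logarithms to base $2$); the running time is measured by the cost of these query and insertion operations. Standing assumption of the paper's analysis: the time and space requirements are assumed to be maximal for $E=S/2$, and all analysis is carried out for $E=S/2$. -}

module Defs where

open import Data.Bool.Base using (if_then_else_)
open import Data.Integer.Base as ℤ using (+_; -[1+_])
open import Data.List.Base as List using (List; []; _∷_; _++_; length; find)
open import Data.Maybe.Base using (Maybe; just; nothing)
open import Data.Nat.Base as ℕ using (ℕ; suc)
open import Data.Nat.ListAction using (product)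
open import Data.Product.Base using (_×_; _,_; proj₂)
open import Data.Rational hiding (truncate)
open import Data.Sum.Base using (_⊎_)
open import Data.Unit.Base using (⊤; tt)
open import Data.Vec.Base as Vec using (Vec; []; _∷_)
open import Relation.Nullary.Decidable using (Dec; does; _×-dec_; _⊎-dec_)

fromℕ : ℕ → ℚ
fromℕ n = + n / 1

------------------------------------------------------------------------
-- The algorithm

record BlockBound : Set where
  constructor [_,_]
  field
    bMAX bMIN : ℚ

open BlockBound public

Contains : ℚ → BlockBound → Set
Contains v b = (bMAX b ≤ v) × (v ≤ bMIN b)

contains? : ∀ v b → Dec (Contains v b)
contains? v b = (bMAX b ≤? v) ×-dec (v ≤? bMIN b)

shift : ℚ → BlockBound → BlockBound
shift a [ l , u ] = [ l + a , u + a ]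

-- The collections V[k], …, V[n].  A collection only matters through its
-- contents and its size: the search-tree cost is charged separately.
Collections : ℕ → Set
Collections m = Vec (List BlockBound) m

-- A run either halts (`nothing`) or returns a value.  In both cases it
-- records, for every query and every insertion performed, the number of
-- block bounds in the collection concerned just before the operation.
Run : Set → Set
Run X = Maybe X × List ℕ

return : ∀ {X} → X → Run X
return x = just x , []

halt : ∀ {X} → Run X
halt = nothing , []

access : List BlockBound → Run ⊤
access T = just tt , length T ∷ []

infixl 1 _>>=_ _>>_

_>>=_ : ∀ {X Y} → Run X → (X → Run Y) → Run Y
(nothing , w) >>= f = nothing , w
(just x  , w) >>= f = let (r , w′) = f x in r , w ++ w′

_>>_ : ∀ {X Y} → Run X → Run Y → Run Y
r >> s = r >>= λ _ → s

combine : ∀ {m} → List BlockBound → BlockBound → BlockBound →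
          Collections m → Run (BlockBound × Collections (suc m))
combine T [ b₁ , b₂ ] [ b₃ , b₄ ] V =
  let b = [ b₁ ⊔ b₃ , b₂ ⊓ b₄ ] in
  access T >> return (b , (b ∷ T) ∷ V)

-- `setSum S p A v V` is SetSum(k,v), where A is the vector a_k, …, a_n,
-- S is the sum of the whole input set, p is a_{k-1}, and V holds the
-- current V[k], …, V[n].  The empty vector is the case k = n+1, where
-- S_{n+1} = 0.  `resume` continues after the query, given its answer.
mutual
  setSum : ∀ {m} (S p : ℚ) → Vec ℕ m → ℚ → Collections m →
           Run (BlockBound × Collections m)
  setSum S p [] v [] =
    if does (0ℚ ≤? v) then return ([ 0ℚ , S ] , [])
    else return ([ - p , 0ℚ ] , [])
  setSum S p (x ∷ A) v (T ∷ V) =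
    let Sₖ = fromℕ (Vec.sum (x ∷ A)) in
    if does (Sₖ ≤? v) then return ([ Sₖ , S ] , T ∷ V)
    else if does (v ≤? 0ℚ) then return ([ - p , 0ℚ ] , T ∷ V)
    else (access T >> resume S x A v T V (find (contains? v) T))

  resume : ∀ {m} (S : ℚ) (x : ℕ) → Vec ℕ m → ℚ →
           List BlockBound → Collections m → Maybe BlockBound →
           Run (BlockBound × Collections (suc m))
  resume S x A v T V (just b) =
    if does ((v ≟ bMAX b) ⊎-dec (v ≟ bMIN b)) then halt
    else return (b , T ∷ V)
  resume S x A v T V nothing =
    let a  = fromℕ x
        Sₖ = fromℕ (Vec.sum (x ∷ A))
    in
    if does (∣ ½ * Sₖ - (v - a) ∣ >? ∣ ½ * Sₖ - v ∣)
    then (do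
      (b₃₄ , V₁) ← setSum S a A v V
      (b₁₂ , V₂) ← setSum S a A (v - a) V₁
      combine T (shift a b₁₂) b₃₄ V₂)
    else (do
      (b₁₂ , V₁) ← setSum S a A (v - a) V
      (b₃₄ , V₂) ← setSum S a A v V₁
      combine T (shift a b₁₂) b₃₄ V₂)

-- There is no a_0; its stand-in 0 is used only if E ≤ 0 < S.
enumPlus : ∀ {n} → Vec ℕ n → ℚ → Run (BlockBound × Collections n)
enumPlus A E = setSum (fromℕ (Vec.sum A)) 0ℚ A E (Vec.replicate _ [])

accessSizes : ∀ {n} → Vec ℕ n → ℚ → List ℕ
accessSizes A E = proj₂ (enumPlus A E)

------------------------------------------------------------------------
-- Real numbers

-- A real x is represented by the set of rationals q with q ≤ x.
Cut : Set₁
Cut = ℚ → Set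

infix 4 _≤ᶜ_

_≤ᶜ_ : Cut → Cut → Set
x ≤ᶜ y = ∀ q → x q → y q

-- p/d ≤ log₂ N iff 2^p ≤ N^d.
log₂ : ℕ → Cut
log₂ N (mkℚ (+ p)    d-1 _) = 2 ℕ.^ p ℕ.≤ N ℕ.^ suc d-1
log₂ N (mkℚ -[1+ p ] d-1 _) = 1 ℕ.≤ N ℕ.^ suc d-1 ℕ.* 2 ℕ.^ suc p

-- The number rat + irr·√m.
record ℚ[√_] (m : ℕ) : Set where
  constructor surd
  field
    rat irr : ℚ

infixl 6 _⊕_ _⊖_
infixr 7 _⊙_

ι : ∀ {m} → ℚ → ℚ[√ m ]
ι q = surd q 0ℚ

√_ : ∀ m → ℚ[√ m ]
√ m = surd 0ℚ 1ℚ

_⊕_ _⊖_ : ∀ {m} → ℚ[√ m ] → ℚ[√ m ] → ℚ[√ m ]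
surd a b ⊕ surd c d = surd (a + c) (b + d)
surd a b ⊖ surd c d = surd (a - c) (b - d)

_⊙_ : ∀ {m} → ℚ → ℚ[√ m ] → ℚ[√ m ]
q ⊙ surd a b = surd (q * a) (q * b)

-- a + b√m ≥ 0, by the signs of a and b.
NonNeg : ∀ {m} → ℚ[√ m ] → Set
NonNeg {m} (surd a b) =
    (0ℚ ≤ a × 0ℚ ≤ b)
  ⊎ (0ℚ ≤ a × b * b * fromℕ m ≤ a * a)
  ⊎ (0ℚ ≤ b × a * a ≤ b * b * fromℕ m)

cut : ∀ {m} → ℚ[√ m ] → Cut
cut x q = NonNeg (x ⊖ ι q)

------------------------------------------------------------------------
-- Complexity

-- The sum of the costs max(1, log₂ N) = log₂ (max(2, N)) of all queries
-- and insertions, N being the size of the collection concerned, as the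
-- logarithm of a product.  The maximum with 1 gives a meaning to N = 0
-- and keeps operations on collections of size at most 1 from being free.
time : ∀ {n} → Vec ℕ n → ℚ → Cut
time A E = log₂ (product (List.map (2 ℕ.⊔_) (accessSizes A E)))

-- √(2 ^ n) is 2^{n/2}, also for odd n.
bound : ℚ → (n : ℕ) → ℚ[√ (2 ℕ.^ n) ]
bound c n = fromℕ n ⊙ √ (2 ℕ.^ n) ⊖ c ⊙ √ (2 ℕ.^ n) ⊕ ι (fromℕ n)

{-# OPTIONS --safe #-}
-- Every block bound stored in V[k] is either a single subset sum of A_k or a
-- pair of subset sums of A_k with none in between, and a miss always inserts a
-- bound not stored before.  So V[k] holds at most 2·2^m bounds, where m = n-k+1,
-- and log₂ |V[k]| ≤ n + 1.  Every call makes at most one query, and every miss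
-- two calls and one insertion.  On the lower half of the levels the calls are
-- charged to the insertions, O(2^{n/2}) in all; on the upper half they form a
-- binary tree of depth n/2.  Hence there are O(2^{n/2}) operations of cost O(n).
module Submission where

open import Data.Bool.Base using (if_then_else_)
open import Data.Fin.Base as Fin using (Fin; zero; suc)
open import Data.Fin.Properties using (injective⇒≤; combine-injective)
import Data.Integer.Base as ℤ
import Data.Integer.Properties as ℤ
open import Data.List.Base as List using (List; []; _∷_; _++_; length; find)
open import Data.List.Membership.Propositional using (_∈_)
open import Data.List.Membership.Propositional.Properties
  using (∈-++⁺ˡ; ∈-++⁺ʳ; ∈-++⁻; ∈-map⁺; ∈-map⁻; ∈-lookup)
open import Data.List.Properties using (length-++; length-map)
open import Data.List.Relation.Unary.All as ListAll using ([]; _∷_) renaming (All to ListAll)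
import Data.List.Relation.Unary.All.Properties as ListAll
open import Data.List.Relation.Unary.Any using (here; there; index)
open import Data.List.Relation.Unary.Any.Properties using (lookup-index)
open import Data.List.Relation.Unary.Unique.Propositional using (Unique; []; _∷_)
open import Data.Maybe.Base using (Maybe; just; nothing)
open import Data.Nat.Base as ℕ using (ℕ; zero; suc; ⌊_/2⌋; ⌈_/2⌉)
open import Data.Nat.ListAction using (product)
import Data.Nat.Properties as ℕ
open import Data.Nat.Solver using (module +-*-Solver)
open import Data.Product.Base using (_×_; _,_; proj₁; proj₂; ∃-syntax)
open import Data.Rational hiding (truncate)
open import Data.Rational.Properties
import Data.Rational.Solver as ℚ
import Data.Rational.Unnormalised.Base as ℚᵘ
import Data.Rational.Unnormalised.Properties as ℚᵘ
open import Data.Sum.Base using (_⊎_; inj₁; inj₂)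
open import Data.Unit.Base using (⊤; tt)
open import Data.Vec.Base as Vec using (Vec; []; _∷_; sum)
open import Data.Vec.Relation.Unary.All using (All)
open import Data.Vec.Relation.Unary.Linked using (Linked)
open import Relation.Binary.PropositionalEquality
  using (_≡_; _≢_; refl; sym; trans; cong; cong₂; subst; subst₂; module ≡-Reasoning)
open import Relation.Nullary using (¬_; Dec; yes; no; does; contradiction)
open import Relation.Nullary.Decidable using (_⊎-dec_)
open import Defs

-- Rationals and subset sums

toℚᵘ-fromℕ : ∀ n → toℚᵘ (fromℕ n) ℚᵘ.≃ ℚᵘ.mkℚᵘ (ℤ.+ n) 0
toℚᵘ-fromℕ n = toℚᵘ-fromℚᵘ (ℚᵘ.mkℚᵘ (ℤ.+ n) 0)

fromℕ-homo-+ : ∀ m n → fromℕ (m ℕ.+ n) ≡ fromℕ m + fromℕ n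
fromℕ-homo-+ m n = toℚᵘ-injective (begin
  toℚᵘ (fromℕ (m ℕ.+ n))                          ≈⟨ toℚᵘ-fromℕ (m ℕ.+ n) ⟩
  ℚᵘ.mkℚᵘ (ℤ.+ (m ℕ.+ n)) 0                       ≈⟨ ℚᵘ.*≡* (cong (ℤ._* ℤ.+ 1) (cong₂ ℤ._+_
                                                       (ℤ.*-identityʳ (ℤ.+ m)) (ℤ.*-identityʳ (ℤ.+ n)))) ⟨
  ℚᵘ.mkℚᵘ (ℤ.+ m) 0 ℚᵘ.+ ℚᵘ.mkℚᵘ (ℤ.+ n) 0        ≈⟨ ℚᵘ.+-cong (toℚᵘ-fromℕ m) (toℚᵘ-fromℕ n) ⟨
  toℚᵘ (fromℕ m) ℚᵘ.+ toℚᵘ (fromℕ n)              ≈⟨ toℚᵘ-homo-+ (fromℕ m) (fromℕ n) ⟨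
  toℚᵘ (fromℕ m + fromℕ n)                        ∎)
  where open ℚᵘ.≃-Reasoning

fromℕ-homo-* : ∀ m n → fromℕ (m ℕ.* n) ≡ fromℕ m * fromℕ n
fromℕ-homo-* m n = toℚᵘ-injective (begin
  toℚᵘ (fromℕ (m ℕ.* n))                          ≈⟨ toℚᵘ-fromℕ (m ℕ.* n) ⟩
  ℚᵘ.mkℚᵘ (ℤ.+ (m ℕ.* n)) 0                       ≈⟨ ℚᵘ.*≡* (cong (ℤ._* ℤ.+ 1) (ℤ.pos-* m n)) ⟩
  ℚᵘ.mkℚᵘ (ℤ.+ m) 0 ℚᵘ.* ℚᵘ.mkℚᵘ (ℤ.+ n) 0        ≈⟨ ℚᵘ.*-cong (toℚᵘ-fromℕ m) (toℚᵘ-fromℕ n) ⟨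
  toℚᵘ (fromℕ m) ℚᵘ.* toℚᵘ (fromℕ n)              ≈⟨ toℚᵘ-homo-* (fromℕ m) (fromℕ n) ⟨
  toℚᵘ (fromℕ m * fromℕ n)                        ∎)
  where open ℚᵘ.≃-Reasoning

fromℕ-mono-≤ : ∀ {m n} → m ℕ.≤ n → fromℕ m ≤ fromℕ n
fromℕ-mono-≤ {m} {n} m≤n = toℚᵘ-cancel-≤ (begin
  toℚᵘ (fromℕ m)     ≃⟨ toℚᵘ-fromℕ m ⟩
  ℚᵘ.mkℚᵘ (ℤ.+ m) 0  ≤⟨ ℚᵘ.*≤* (ℤ.*-monoʳ-≤-nonNeg (ℤ.+ 1) (ℤ.+≤+ m≤n)) ⟩
  ℚᵘ.mkℚᵘ (ℤ.+ n) 0  ≃⟨ toℚᵘ-fromℕ n ⟨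
  toℚᵘ (fromℕ n)     ∎)
  where open ℚᵘ.≤-Reasoning

0≤fromℕ : ∀ n → 0ℚ ≤ fromℕ n
0≤fromℕ n = fromℕ-mono-≤ {0} {n} ℕ.z≤n

-- Repetitions are kept, so that the length is exactly `2 ^ m` and positions can serve as keys when
-- block bounds are counted.
subsetSums : ∀ {m} → Vec ℕ m → List ℚ
subsetSums []      = 0ℚ ∷ []
subsetSums (x ∷ A) = subsetSums A ++ List.map (_+ fromℕ x) (subsetSums A)

length-subsetSums : ∀ {m} (A : Vec ℕ m) → length (subsetSums A) ≡ 2 ℕ.^ m
length-subsetSums []      = refl
length-subsetSums {suc m} (x ∷ A) = begin
  length (sums ++ List.map (_+ fromℕ x) sums)              ≡⟨ length-++ sums ⟩
  length sums ℕ.+ length (List.map (_+ fromℕ x) sums)      ≡⟨ cong (length sums ℕ.+_) (length-map _ sums) ⟩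
  length sums ℕ.+ length sums                              ≡⟨ cong (length sums ℕ.+_) (ℕ.+-identityʳ _) ⟨
  2 ℕ.* length sums                                        ≡⟨ cong (2 ℕ.*_) (length-subsetSums A) ⟩
  2 ℕ.^ suc m                                              ∎
  where
  open ≡-Reasoning
  sums = subsetSums A

sum-without : ∀ {m} x (A : Vec ℕ m) {s} → s ∈ subsetSums A → s ∈ subsetSums (x ∷ A)
sum-without x A s∈ = ∈-++⁺ˡ s∈

sum-with : ∀ {m} x (A : Vec ℕ m) {s} → s ∈ subsetSums A → s + fromℕ x ∈ subsetSums (x ∷ A)
sum-with x A s∈ = ∈-++⁺ʳ (subsetSums A) (∈-map⁺ (_+ fromℕ x) s∈)

0∈subsetSums : ∀ {m} (A : Vec ℕ m) → 0ℚ ∈ subsetSums A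
0∈subsetSums []      = here refl
0∈subsetSums (x ∷ A) = sum-without x A (0∈subsetSums A)

fromℕ-sum : ∀ {m} x (A : Vec ℕ m) → fromℕ (sum A) + fromℕ x ≡ fromℕ (sum (x ∷ A))
fromℕ-sum x A = trans (+-comm (fromℕ (sum A)) (fromℕ x)) (sym (fromℕ-homo-+ x (sum A)))

sum∈subsetSums : ∀ {m} (A : Vec ℕ m) → fromℕ (sum A) ∈ subsetSums A
sum∈subsetSums []      = here refl
sum∈subsetSums (x ∷ A) = subst (_∈ subsetSums (x ∷ A)) (fromℕ-sum x A) (sum-with x A (sum∈subsetSums A))

subsetSums-cases : ∀ {m} x (A : Vec ℕ m) {s} → s ∈ subsetSums (x ∷ A) →
  s ∈ subsetSums A ⊎ ∃[ t ] t ∈ subsetSums A × s ≡ t + fromℕ x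
subsetSums-cases x A s∈ with ∈-++⁻ (subsetSums A) s∈
... | inj₁ s∈A = inj₁ s∈A
... | inj₂ s∈A+x = inj₂ (∈-map⁻ (_+ fromℕ x) s∈A+x)

subsetSum-bounds : ∀ {m} (A : Vec ℕ m) {s} → s ∈ subsetSums A → 0ℚ ≤ s × s ≤ fromℕ (sum A)
subsetSum-bounds []      (here refl) = ≤-refl , ≤-refl
subsetSum-bounds (x ∷ A) s∈ with subsetSums-cases x A s∈
... | inj₁ s∈A with 0≤s , s≤S ← subsetSum-bounds A s∈A =
  0≤s , ≤-trans s≤S (fromℕ-mono-≤ (ℕ.m≤n+m (sum A) x))
... | inj₂ (t , t∈A , refl) with 0≤t , t≤S ← subsetSum-bounds A t∈A =
  +-mono-≤ 0≤t (0≤fromℕ x) , ≤-trans (+-monoˡ-≤ (fromℕ x) t≤S) (≤-reflexive (fromℕ-sum x A))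

-- Searching and counting in lists

find-nothing : ∀ {X : Set} {P : X → Set} (P? : ∀ x → Dec (P x)) xs →
  find P? xs ≡ nothing → ListAll (λ x → ¬ P x) xs
find-nothing P? []       _  = []
find-nothing P? (x ∷ xs) eq with P? x
... | no ¬px = ¬px ∷ find-nothing P? xs eq

find-just : ∀ {X : Set} {P : X → Set} (P? : ∀ x → Dec (P x)) xs {x} →
  find P? xs ≡ just x → x ∈ xs × P x
find-just P? (y ∷ xs) eq with P? y
find-just P? (y ∷ xs) refl | yes py = here refl , py
... | no _ with x∈ , px ← find-just P? xs eq = there x∈ , px

lookup-injective : ∀ {X : Set} {xs : List X} → Unique xs →
  ∀ i j → List.lookup xs i ≡ List.lookup xs j → i ≡ j
lookup-injective (_   ∷ _)  zero    zero    _  = refl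
lookup-injective (x∉ ∷ _)  zero    (suc j) eq = contradiction eq (ListAll.lookup x∉ (∈-lookup j))
lookup-injective (x∉ ∷ _)  (suc i) zero    eq = contradiction (sym eq) (ListAll.lookup x∉ (∈-lookup i))
lookup-injective (_   ∷ xs!) (suc i) (suc j) eq = cong suc (lookup-injective xs! i j eq)

-- Composing `f` with lookup gives an injection between finite sets. `f` takes membership proofs
-- because the key of a stored bound is read off the `Gap` kept at its position.
unique-length-≤ : ∀ {X : Set} {xs : List X} {n} → Unique xs →
  (f : ∀ {x} → x ∈ xs → Fin n) →
  (∀ {x y} (x∈ : x ∈ xs) (y∈ : y ∈ xs) → f x∈ ≡ f y∈ → x ≡ y) →
  length xs ℕ.≤ n
unique-length-≤ xs! f f-injective =
  injective⇒≤ {f = λ i → f (∈-lookup i)}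
    (λ {i} {j} eq → lookup-injective xs! i j (f-injective (∈-lookup i) (∈-lookup j) eq))

-- Stored block bounds and their number

Separates : ∀ {m} → Vec ℕ m → BlockBound → Set
Separates A b = ∀ {s} → s ∈ subsetSums A → s ≤ bMAX b ⊎ bMIN b ≤ s

-- The invariant of a stored bound. It mentions no capacity, so it remains usable by every later
-- query.
record Gap {m} (A : Vec ℕ m) (b : BlockBound) : Set where
  field
    lower     : bMAX b ∈ subsetSums A
    upper     : bMIN b ∈ subsetSums A
    ordered   : bMAX b ≤ bMIN b
    separates : Separates A b

-- Two bounds with the same bMAX may both be stored: [s , s] and [s , u] with s < u.
degenerate : BlockBound → Fin 2
degenerate b with bMAX b ≟ bMIN b
... | yes _ = zero
... | no  _ = suc zero

-- If neither interval is degenerate, both upper ends lie strictly above the common lower end, so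
-- each interval forces the upper end of the other to be at least its own.
Gap-unique : ∀ {m} {A : Vec ℕ m} {b c} → Gap A b → Gap A c →
  degenerate b ≡ degenerate c → bMAX b ≡ bMAX c → b ≡ c
Gap-unique {b = [ l , u ]} {[ .l , w ]} B C eq refl with l ≟ u | l ≟ w
... | yes refl | yes refl = refl
... | no l≢u | no l≢w
  with Gap.separates B (Gap.upper C) | Gap.separates C (Gap.upper B)
... | inj₁ w≤l | _        = contradiction (≤-antisym (Gap.ordered C) w≤l) l≢w
... | inj₂ _   | inj₁ u≤l = contradiction (≤-antisym (Gap.ordered B) u≤l) l≢u
... | inj₂ u≤w | inj₂ w≤u = cong ([_,_] l) (≤-antisym u≤w w≤u)

index-injective : ∀ {X : Set} {x y : X} {xs} (x∈ : x ∈ xs) (y∈ : y ∈ xs) →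
  index x∈ ≡ index y∈ → x ≡ y
index-injective {xs = xs} x∈ y∈ eq =
  trans (lookup-index x∈) (trans (cong (List.lookup xs) eq) (sym (lookup-index y∈)))

-- Degeneracy and the position of `bMAX` among the subset sums determine a stored bound, which
-- leaves `2 * 2 ^ m` keys.
gaps-length : ∀ {m} (A : Vec ℕ m) {T} → ListAll (Gap A) T → Unique T →
  length T ℕ.≤ 2 ℕ.^ suc m
gaps-length A {T} gaps T! = subst (λ k → length T ℕ.≤ 2 ℕ.* k) (length-subsetSums A)
  (unique-length-≤ T! key λ b∈ c∈ eq →
    let B = ListAll.lookup gaps b∈
        C = ListAll.lookup gaps c∈
        d , i = combine-injective _ (index (Gap.lower B)) _ (index (Gap.lower C)) eq
    in Gap-unique B C d (index-injective (Gap.lower B) (Gap.lower C) i))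
  where
  key : ∀ {b} → b ∈ T → Fin (2 ℕ.* length (subsetSums A))
  key {b} b∈ = Fin.combine (degenerate b) (index (Gap.lower (ListAll.lookup gaps b∈)))

-- The second alternatives are the sentinels -a_{k-1} and S of steps (2) and (1).
record Bracket {m} (S p : ℚ) (A : Vec ℕ m) (v : ℚ) (b : BlockBound) : Set where
  field
    contains  : Contains v b
    lower     : bMAX b ∈ subsetSums A ⊎ (bMAX b ≡ - p × v ≤ 0ℚ)
    upper     : bMIN b ∈ subsetSums A ⊎ (bMIN b ≡ S × fromℕ (sum A) ≤ v)
    separates : Separates A b

Gap⇒Bracket : ∀ {m} {S p} {A : Vec ℕ m} {v b} → Gap A b → Contains v b → Bracket S p A v b
Gap⇒Bracket B v∈b = record
  { contains  = v∈b
  ; lower     = inj₁ (Gap.lower B)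
  ; upper     = inj₁ (Gap.upper B)
  ; separates = Gap.separates B
  }

above-bracket : ∀ {m} {S p} (A : Vec ℕ m) {v} → fromℕ (sum A) ≤ v → v ≤ S →
  Bracket S p A v [ fromℕ (sum A) , S ]
above-bracket A Sₖ≤v v≤S = record
  { contains  = Sₖ≤v , v≤S
  ; lower     = inj₁ (sum∈subsetSums A)
  ; upper     = inj₂ (refl , Sₖ≤v)
  ; separates = λ s∈ → inj₁ (proj₂ (subsetSum-bounds A s∈))
  }

below-bracket : ∀ {m} {S p} (A : Vec ℕ m) {v} → - p ≤ v → v ≤ 0ℚ →
  Bracket S p A v [ - p , 0ℚ ]
below-bracket A -p≤v v≤0 = record
  { contains  = -p≤v , v≤0
  ; lower     = inj₂ (refl , v≤0)
  ; upper     = inj₁ (0∈subsetSums A)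
  ; separates = λ s∈ → inj₂ (proj₁ (subsetSum-bounds A s∈))
  }

-- Shifting and joining block bounds

p-q+q≡p : ∀ p q → p - q + q ≡ p
p-q+q≡p p q = trans (+-assoc p (- q) q) (trans (cong (p +_) (+-inverseˡ q)) (+-identityʳ p))

shift-contains : ∀ {a v b} → Contains (v - a) b → Contains v (shift a b)
shift-contains {a} {v} {b} (l≤ , ≤u) =
    ≤-trans (+-monoˡ-≤ a l≤) (≤-reflexive (p-q+q≡p v a))
  , ≤-trans (≤-reflexive (sym (p-q+q≡p v a))) (+-monoˡ-≤ a ≤u)

join : BlockBound → BlockBound → BlockBound
join b c = [ bMAX b ⊔ bMAX c , bMIN b ⊓ bMIN c ]

join-contains : ∀ {v b c} → Contains v b → Contains v c → Contains v (join b c)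
join-contains (l₁ , u₁) (l₂ , u₂) = ⊔-lub l₁ l₂ , ⊓-glb u₁ u₂

⊔-elim : ∀ (P : ℚ → Set) {p q} → P p → P q → P (p ⊔ q)
⊔-elim P {p} {q} Pp Pq with ⊔-sel p q
... | inj₁ eq = subst P (sym eq) Pp
... | inj₂ eq = subst P (sym eq) Pq

⊓-elim : ∀ (P : ℚ → Set) {p q} → P p → P q → P (p ⊓ q)
⊓-elim P {p} {q} Pp Pq with ⊓-sel p q
... | inj₁ eq = subst P (sym eq) Pp
... | inj₂ eq = subst P (sym eq) Pq

-- Every subset sum of `x ∷ A` belongs to one of the two branches, so separation carries over. The
-- issue is the sentinels: when steps (1) and (2) do not apply to `v`, none of them survives the
-- join as a value that is not a subset sum.
join-gap : ∀ {m S v b c} x (A : Vec ℕ m) →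
  ¬ fromℕ (sum (x ∷ A)) ≤ v → ¬ v ≤ 0ℚ → fromℕ (sum (x ∷ A)) ≤ S →
  Bracket S (fromℕ x) A (v - fromℕ x) b → Bracket S (fromℕ x) A v c →
  Gap (x ∷ A) (join (shift (fromℕ x) b) c) × Contains v (join (shift (fromℕ x) b) c)
join-gap {S = S} {v} {b} {c} x A Sₖ≰v v≰0 Sₖ≤S B C = record
  { lower     = ⊔-elim (_∈ subsetSums (x ∷ A)) b-lower c-lower
  ; upper     = join-upper
  ; ordered   = ≤-trans (proj₁ v∈) (proj₂ v∈)
  ; separates = join-separates
  } , v∈
  where
  module B = Bracket B
  module C = Bracket C
  a = fromℕ x
  v∈ : Contains v (join (shift a b) c)
  v∈ = join-contains {b = shift a b} {c} (shift-contains {b = b} B.contains) C.contains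

  b-lower : bMAX b + a ∈ subsetSums (x ∷ A)
  b-lower with B.lower
  ... | inj₁ l∈         = sum-with x A l∈
  -- The shift turns the sentinel `- a` into 0, the sum of the empty subset.
  ... | inj₂ (refl , _) = subst (_∈ subsetSums (x ∷ A)) (sym (+-inverseˡ a)) (0∈subsetSums (x ∷ A))

  c-lower : bMAX c ∈ subsetSums (x ∷ A)
  c-lower with C.lower
  ... | inj₁ l∈        = sum-without x A l∈
  ... | inj₂ (_ , v≤0) = contradiction v≤0 v≰0

  b-upper : bMIN b + a ∈ subsetSums (x ∷ A)
  b-upper with B.upper
  ... | inj₁ u∈ = sum-with x A u∈
  -- An upper sentinel in this branch would put `v` in the range of step (1).
  ... | inj₂ (_ , S≤v-a) = contradiction
    (subst₂ _≤_ (fromℕ-sum x A) (p-q+q≡p v a) (+-monoˡ-≤ a S≤v-a)) Sₖ≰v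

  join-upper : (bMIN b + a) ⊓ bMIN c ∈ subsetSums (x ∷ A)
  join-upper with C.upper
  ... | inj₁ u∈ = ⊓-elim (_∈ subsetSums (x ∷ A)) b-upper (sum-without x A u∈)
  -- Here the sentinel `S` can occur, but the minimum discards it in favour of the other end, a
  -- subset sum and hence at most `S`.
  ... | inj₂ (refl , _) = subst (_∈ subsetSums (x ∷ A))
    (sym (p≤q⇒p⊓q≡p (≤-trans (proj₂ (subsetSum-bounds (x ∷ A) b-upper)) Sₖ≤S))) b-upper

  join-separates : Separates (x ∷ A) (join (shift a b) c)
  join-separates s∈ with subsetSums-cases x A s∈
  ... | inj₁ s∈A with C.separates s∈A
  ...   | inj₁ s≤l = inj₁ (≤-trans s≤l (p≤q⊔p (bMAX b + a) (bMAX c)))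
  ...   | inj₂ u≤s = inj₂ (≤-trans (p⊓q≤q (bMIN b + a) (bMIN c)) u≤s)
  join-separates s∈ | inj₂ (t , t∈A , refl) with B.separates t∈A
  ...   | inj₁ t≤l = inj₁ (≤-trans (+-monoˡ-≤ a t≤l) (p≤p⊔q (bMAX b + a) (bMAX c)))
  ...   | inj₂ u≤t = inj₂ (≤-trans (p⊓q≤p (bMIN b + a) (bMIN c)) (+-monoˡ-≤ a u≤t))

-- Amortised analysis of the number of operations

-- `H` is the condition on the number of operations of a run that halts.
Outcome : ∀ {X : Set} → (X → ℕ → Set) → (ℕ → Set) → Maybe X → ℕ → Set
Outcome Q H (just x) = Q x
Outcome Q H nothing  = H

-- A Hoare-style specification in which the postcondition also sees the number of operations
-- performed.
record Ensures {X : Set} (N : ℕ) (Q : X → ℕ → Set) (H : ℕ → Set) (r : Run X) : Set where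
  constructor ensures
  field
    sizes   : ListAll (ℕ._≤ N) (proj₂ r)
    outcome : Outcome Q H (proj₁ r) (length (proj₂ r))

-- The operations of the first run enter the conditions on the second as the offset `k`, so a halt
-- in the second run is charged for both.
>>=-ensures : ∀ {X Y : Set} {N} {Q : X → ℕ → Set} {Q′ : Y → ℕ → Set} {H H′ : ℕ → Set} {r f} →
  Ensures N Q H r → (∀ {k} → H k → H′ k) →
  (∀ x k → Q x k → Ensures N (λ y l → Q′ y (k ℕ.+ l)) (λ l → H′ (k ℕ.+ l)) (f x)) →
  Ensures N Q′ H′ (r >>= f)
>>=-ensures {r = nothing , w} (ensures ws h) H⇒H′ _ = ensures ws (H⇒H′ h)
>>=-ensures {Q′ = Q′} {H′ = H′} {r = just x , w} {f} (ensures ws q) _ next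
  with f x | next x (length w) q
... | just y  , w′ | ensures ws′ q′ =
  ensures (ListAll.++⁺ ws ws′) (subst (Q′ y) (sym (length-++ w)) q′)
... | nothing , w′ | ensures ws′ h′ =
  ensures (ListAll.++⁺ ws ws′) (subst H′ (sym (length-++ w)) h′)

Ensures-mono : ∀ {X : Set} {M N} {Q : X → ℕ → Set} {H r} →
  M ℕ.≤ N → Ensures M Q H r → Ensures N Q H r
Ensures-mono M≤N (ensures ws o) = ensures (ListAll.map (λ s≤M → ℕ.≤-trans s≤M M≤N) ws) o

if-elim : ∀ {X B : Set} (P : X → Set) (d : Dec B) {x y} →
  (B → P x) → (¬ B → P y) → P (if does d then x else y)
if-elim P (yes b) Px Py = Px b
if-elim P (no ¬b) Px Py = Py ¬b

Valid : ∀ {m} → Vec ℕ m → Collections m → Set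
Valid []      []      = ⊤
Valid (x ∷ A) (T ∷ V) = (ListAll (Gap (x ∷ A)) T × Unique T) × Valid A V

empty-valid : ∀ {m} (A : Vec ℕ m) → Valid A (Vec.replicate m [])
empty-valid []      = tt
empty-valid (x ∷ A) = ([] , []) , empty-valid A

-- A call answered from its collection makes one query and must leave 2 operations unspent, hence
-- the 3.
module Amortised (budget : ℕ → ℕ) (3≤budget : ∀ m → 3 ℕ.≤ budget m) where

  -- The credit of a block bound in a collection for m + 1 remaining elements:
  -- what the budgets of two calls on m elements exceed that of their parent.
  rate : ℕ → ℕ
  rate m = 2 ℕ.* budget m ℕ.∸ budget (suc m)

  potential : ∀ {m} → Collections m → ℕ
  potential []              = 0
  potential {suc m} (T ∷ V) = rate m ℕ.* length T ℕ.+ potential V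

  -- The extra 1 stands for the insertion that a halt prevents.
  reserve : ℕ → ℕ
  reserve zero    = 0
  reserve (suc m) = rate m ℕ.* suc (2 ℕ.^ suc (suc m)) ℕ.+ reserve m

  empty-potential : ∀ m → potential {m} (Vec.replicate m []) ≡ 0
  empty-potential zero    = refl
  empty-potential (suc m) = cong₂ ℕ._+_ (ℕ.*-zeroʳ (rate m)) (empty-potential m)

  potential≤reserve : ∀ {m} (A : Vec ℕ m) (V : Collections m) → Valid A V →
    potential V ℕ.≤ reserve m
  potential≤reserve []              []      _ = ℕ.z≤n
  potential≤reserve {suc m} (x ∷ A) (T ∷ V) ((gaps , T!) , valid) = ℕ.+-mono-≤
    (ℕ.*-monoʳ-≤ (rate m) (ℕ.m≤n⇒m≤1+n (gaps-length (x ∷ A) gaps T!)))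
    (potential≤reserve A V valid)

  -- The run leaves e operations of its budget unspent.  Of the 2 + 2 left by a
  -- pair of calls, 2 pay for the caller's query and insertion.
  Affordable : ∀ {m} → Vec ℕ m → ℕ → Collections m → (BlockBound → Set) →
    Run (BlockBound × Collections m) → Set
  Affordable {m} A e V P = Ensures (2 ℕ.^ suc m)
    (λ (b , V′) k → P b × Valid A V′ × k ℕ.+ e ℕ.+ potential V ℕ.≤ budget m ℕ.+ potential V′)
    (λ k → k ℕ.+ e ℕ.+ potential V ℕ.≤ budget m ℕ.+ reserve m)

  -- Returning and halting give the same bound, because the final potential of a valid state never
  -- exceeds the reserve.
  affordable-length : ∀ {m e} {A : Vec ℕ m} {V P} r → Affordable A e V P r →
    length (proj₂ r) ℕ.≤ budget m ℕ.+ reserve m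
  affordable-length {m} {e} {A} {V} (just (_ , V′) , w) (ensures _ (_ , valid , h)) =
    ℕ.≤-trans (ℕ.m≤m+n (length w) e) (ℕ.≤-trans (ℕ.m≤m+n _ (potential V))
      (ℕ.≤-trans h (ℕ.+-monoʳ-≤ (budget m) (potential≤reserve A V′ valid))))
  affordable-length {m} {e} {A} {V} (nothing , w) (ensures _ h) =
    ℕ.≤-trans (ℕ.m≤m+n (length w) e) (ℕ.≤-trans (ℕ.m≤m+n _ (potential V)) h)

  -- Truncated subtraction can only overestimate the difference, so the credit of one bound always
  -- covers the excess of two calls.
  budget-step : ∀ m → 2 ℕ.* budget m ℕ.≤ budget (suc m) ℕ.+ rate m
  budget-step m = ℕ.m≤n+m∸n (2 ℕ.* budget m) (budget (suc m))

  module _ {m} (x : ℕ) (A : Vec ℕ m) {T : List BlockBound}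
           (gaps : ListAll (Gap (x ∷ A)) T) (T! : Unique T) where

    halt-affordable : ∀ {k X} → k ℕ.+ 4 ℕ.+ X ℕ.≤ 2 ℕ.* budget m ℕ.+ reserve m →
      k ℕ.+ 3 ℕ.+ (rate m ℕ.* length T ℕ.+ X) ℕ.≤ budget (suc m) ℕ.+ reserve (suc m)
    halt-affordable {k} {X} k≤ = begin
      -- The operation given away is the one that would have paid for the insertion.
      k ℕ.+ 3 ℕ.+ (r ℕ.* t ℕ.+ X)                     ≤⟨ ℕ.m≤n+m _ 1 ⟩
      1 ℕ.+ (k ℕ.+ 3 ℕ.+ (r ℕ.* t ℕ.+ X))             ≡⟨ arrange₁ k (r ℕ.* t) X ⟩
      k ℕ.+ 4 ℕ.+ X ℕ.+ r ℕ.* t                       ≤⟨ ℕ.+-mono-≤ k≤ (ℕ.*-monoʳ-≤ r (gaps-length _ gaps T!)) ⟩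
      2 ℕ.* budget m ℕ.+ reserve m ℕ.+ r ℕ.* M        ≤⟨ ℕ.+-monoˡ-≤ _ (ℕ.+-monoˡ-≤ _ (budget-step m)) ⟩
      budget (suc m) ℕ.+ r ℕ.+ reserve m ℕ.+ r ℕ.* M  ≡⟨ arrange₂ (budget (suc m)) r (reserve m) M ⟩
      budget (suc m) ℕ.+ (r ℕ.* suc M ℕ.+ reserve m)  ∎
      where
      open ℕ.≤-Reasoning
      open +-*-Solver
      r = rate m
      t = length T
      M = 2 ℕ.^ suc (suc m)
      arrange₁ : ∀ k y X → 1 ℕ.+ (k ℕ.+ 3 ℕ.+ (y ℕ.+ X)) ≡ k ℕ.+ 4 ℕ.+ X ℕ.+ y
      arrange₁ = solve 3 (λ k y X → con 1 :+ (k :+ con 3 :+ (y :+ X)) := k :+ con 4 :+ X :+ y) refl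
      arrange₂ : ∀ b r h M → b ℕ.+ r ℕ.+ h ℕ.+ r ℕ.* M ≡ b ℕ.+ (r ℕ.* suc M ℕ.+ h)
      arrange₂ = solve 4 (λ b r h M → b :+ r :+ h :+ r :* M := b :+ (r :* (con 1 :+ M) :+ h)) refl

    -- The potential `Y` between the two calls telescopes.
    calls-add : ∀ {k l c₁ c₂ X Y Z} → k ℕ.+ 2 ℕ.+ X ℕ.≤ c₁ ℕ.+ Y →
      l ℕ.+ 2 ℕ.+ Y ℕ.≤ c₂ ℕ.+ Z →
      k ℕ.+ l ℕ.+ 4 ℕ.+ X ℕ.≤ c₁ ℕ.+ c₂ ℕ.+ Z
    calls-add {k} {l} {c₁} {c₂} {X} {Y} {Z} h₁ h₂ = ℕ.+-cancelʳ-≤ Y _ _ (begin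
      k ℕ.+ l ℕ.+ 4 ℕ.+ X ℕ.+ Y                  ≡⟨ arrange₁ k l X Y ⟩
      (k ℕ.+ 2 ℕ.+ X) ℕ.+ (l ℕ.+ 2 ℕ.+ Y)        ≤⟨ ℕ.+-mono-≤ h₁ h₂ ⟩
      (c₁ ℕ.+ Y) ℕ.+ (c₂ ℕ.+ Z)                  ≡⟨ arrange₂ c₁ c₂ Y Z ⟩
      c₁ ℕ.+ c₂ ℕ.+ Z ℕ.+ Y                      ∎)
      where
      open ℕ.≤-Reasoning
      open +-*-Solver
      arrange₁ : ∀ k l X Y → k ℕ.+ l ℕ.+ 4 ℕ.+ X ℕ.+ Y ≡ (k ℕ.+ 2 ℕ.+ X) ℕ.+ (l ℕ.+ 2 ℕ.+ Y)
      arrange₁ = solve 4 (λ k l X Y →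
        k :+ l :+ con 4 :+ X :+ Y := (k :+ con 2 :+ X) :+ (l :+ con 2 :+ Y)) refl
      arrange₂ : ∀ c₁ c₂ Y Z → (c₁ ℕ.+ Y) ℕ.+ (c₂ ℕ.+ Z) ≡ c₁ ℕ.+ c₂ ℕ.+ Z ℕ.+ Y
      arrange₂ = solve 4 (λ c₁ c₂ Y Z → (c₁ :+ Y) :+ (c₂ :+ Z) := c₁ :+ c₂ :+ Z :+ Y) refl

    -- The new bound raises the potential by `rate m`, which makes up for the two budgets spent
    -- below. Of the 4 unspent operations one pays for the insertion and 3 are passed on.
    insert-affordable : ∀ {k l X Z} → k ℕ.+ l ℕ.+ 4 ℕ.+ X ℕ.≤ 2 ℕ.* budget m ℕ.+ Z →
      k ℕ.+ (l ℕ.+ 1) ℕ.+ 3 ℕ.+ (rate m ℕ.* length T ℕ.+ X) ℕ.≤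
      budget (suc m) ℕ.+ (rate m ℕ.* suc (length T) ℕ.+ Z)
    insert-affordable {k} {l} {X} {Z} h = begin
      k ℕ.+ (l ℕ.+ 1) ℕ.+ 3 ℕ.+ (r ℕ.* t ℕ.+ X)   ≡⟨ arrange₁ k l (r ℕ.* t) X ⟩
      k ℕ.+ l ℕ.+ 4 ℕ.+ X ℕ.+ r ℕ.* t             ≤⟨ ℕ.+-monoˡ-≤ (r ℕ.* t) h ⟩
      2 ℕ.* budget m ℕ.+ Z ℕ.+ r ℕ.* t            ≤⟨ ℕ.+-monoˡ-≤ (r ℕ.* t) (ℕ.+-monoˡ-≤ Z (budget-step m)) ⟩
      budget (suc m) ℕ.+ r ℕ.+ Z ℕ.+ r ℕ.* t      ≡⟨ arrange₂ (budget (suc m)) r Z t ⟩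
      budget (suc m) ℕ.+ (r ℕ.* suc t ℕ.+ Z)      ∎
      where
      open ℕ.≤-Reasoning
      open +-*-Solver
      r = rate m
      t = length T
      arrange₁ : ∀ k l y X → k ℕ.+ (l ℕ.+ 1) ℕ.+ 3 ℕ.+ (y ℕ.+ X) ≡ k ℕ.+ l ℕ.+ 4 ℕ.+ X ℕ.+ y
      arrange₁ = solve 4 (λ k l y X →
        k :+ (l :+ con 1) :+ con 3 :+ (y :+ X) := k :+ l :+ con 4 :+ X :+ y) refl
      arrange₂ : ∀ b r Z t → b ℕ.+ r ℕ.+ Z ℕ.+ r ℕ.* t ≡ b ℕ.+ (r ℕ.* suc t ℕ.+ Z)
      arrange₂ = solve 4 (λ b r Z t → b :+ r :+ Z :+ r :* t := b :+ (r :* (con 1 :+ t) :+ Z)) refl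

    -- One argument serves both branch orders: `P₁` and `P₂` follow the order of execution, and
    -- `joined` restores the roles of the two results.
    call-pair : ∀ {P₁ P₂ P : BlockBound → Set} {V}
      {r₁ : Run (BlockBound × Collections m)}
      {r₂ : Collections m → Run (BlockBound × Collections m)}
      (joined : BlockBound → BlockBound → BlockBound) →
      (∀ {b c} → P₁ b → P₂ c → Gap (x ∷ A) (joined b c) × ListAll (joined b c ≢_) T ×
        P (joined b c)) →
      Affordable A 2 V P₁ r₁ → (∀ V₁ → Valid A V₁ → Affordable A 2 V₁ P₂ (r₂ V₁)) →
      Affordable (x ∷ A) 3 (T ∷ V) P
        (r₁ >>= λ (b , V₁) → r₂ V₁ >>= λ (c , V₂) →
          access T >> return (joined b c , (joined b c ∷ T) ∷ V₂))
    call-pair {V = V} joined P-joined s₁ s₂ =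
      >>=-ensures (Ensures-mono sizes↑ s₁)
        (λ {k} h → halt-affordable {k} (first-halt {k} h))
        λ (b , V₁) k (Pb , valid₁ , h₁) →
      >>=-ensures (Ensures-mono sizes↑ (s₂ V₁ valid₁))
        (λ {l} h → halt-affordable {k ℕ.+ l}
          (ℕ.≤-trans (calls-add {k} {l} h₁ h) (ℕ.≤-reflexive (double (reserve m)))))
        λ (c , V₂) l (Pc , valid₂ , h₂) →
      let gap , fresh , Pj = P-joined Pb Pc in
      ensures (gaps-length (x ∷ A) gaps T! ∷ [])
        ( Pj
        , ((gap ∷ gaps , fresh ∷ T!) , valid₂)
        , insert-affordable {k} {l}
            (ℕ.≤-trans (calls-add {k} {l} h₁ h₂) (ℕ.≤-reflexive (double (potential V₂)))))
      where
      open ℕ.≤-Reasoning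
      open +-*-Solver
      sizes↑ : 2 ℕ.^ suc m ℕ.≤ 2 ℕ.^ suc (suc m)
      sizes↑ = ℕ.^-monoʳ-≤ 2 (ℕ.n≤1+n (suc m))
      double : ∀ Z → budget m ℕ.+ budget m ℕ.+ Z ≡ 2 ℕ.* budget m ℕ.+ Z
      double Z = cong (λ c → budget m ℕ.+ c ℕ.+ Z) (sym (ℕ.+-identityʳ (budget m)))
      -- The second call never starts, so 2 operations of its budget replace those it would have
      -- left unspent.
      first-halt : ∀ {k X} → k ℕ.+ 2 ℕ.+ X ℕ.≤ budget m ℕ.+ reserve m →
        k ℕ.+ 4 ℕ.+ X ℕ.≤ 2 ℕ.* budget m ℕ.+ reserve m
      first-halt {k} {X} h = begin
        k ℕ.+ 4 ℕ.+ X                              ≡⟨ arrange k X ⟩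
        2 ℕ.+ (k ℕ.+ 2 ℕ.+ X)                      ≤⟨ ℕ.+-mono-≤ (ℕ.≤-trans (ℕ.n≤1+n 2) (3≤budget m)) h ⟩
        budget m ℕ.+ (budget m ℕ.+ reserve m)      ≡⟨ ℕ.+-assoc (budget m) (budget m) (reserve m) ⟨
        budget m ℕ.+ budget m ℕ.+ reserve m        ≡⟨ double (reserve m) ⟩
        2 ℕ.* budget m ℕ.+ reserve m               ∎
        where
        arrange : ∀ k X → k ℕ.+ 4 ℕ.+ X ≡ 2 ℕ.+ (k ℕ.+ 2 ℕ.+ X)
        arrange = solve 2 (λ k X → k :+ con 4 :+ X := con 2 :+ (k :+ con 2 :+ X)) refl

  return-affordable : ∀ {m e} {A : Vec ℕ m} {V P b} → e ℕ.≤ 3 → Valid A V → P b →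
    Affordable A e V P (return (b , V))
  return-affordable {m} {V = V} e≤3 valid Pb =
    ensures [] (Pb , valid , ℕ.+-monoˡ-≤ (potential V) (ℕ.≤-trans e≤3 (3≤budget m)))

  mutual
    -- The conditions `v ≤ S` and `- p ≤ v` ensure that the sentinels of steps (1) and (2) really
    -- enclose `v`.
    setSum-affordable : ∀ {m S p v} (A : Vec ℕ m) (V : Collections m) → Valid A V →
      fromℕ (sum A) ≤ S → v ≤ S → - p ≤ v →
      Affordable A 2 V (Bracket S p A v) (setSum S p A v V)
    setSum-affordable {S = S} {p} {v} [] [] valid Sₖ≤S v≤S -p≤v =
      if-elim (Affordable [] 2 [] (Bracket S p [] v)) (0ℚ ≤? v)
        (λ 0≤v → return-affordable (ℕ.n≤1+n 2) tt (above-bracket [] 0≤v v≤S))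
        (λ 0≰v → return-affordable (ℕ.n≤1+n 2) tt (below-bracket [] -p≤v (<⇒≤ (≰⇒> 0≰v))))
    setSum-affordable {suc m} {S} {p} {v} (x ∷ A) (T ∷ V) valid@((gaps , T!) , _) Sₖ≤S v≤S -p≤v =
      if-elim (Affordable (x ∷ A) 2 (T ∷ V) (Bracket S p (x ∷ A) v)) (fromℕ (sum (x ∷ A)) ≤? v)
        (λ Sₖ≤v → return-affordable (ℕ.n≤1+n 2) valid (above-bracket (x ∷ A) Sₖ≤v v≤S))
        λ Sₖ≰v →
      if-elim (Affordable (x ∷ A) 2 (T ∷ V) (Bracket S p (x ∷ A) v)) (v ≤? 0ℚ)
        (λ v≤0 → return-affordable (ℕ.n≤1+n 2) valid (below-bracket (x ∷ A) -p≤v v≤0))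
        λ v≰0 →
      charge-query (resume-affordable x A T V valid Sₖ≤S Sₖ≰v v≰0 (find (contains? v) T) refl)
      where
      one-more : ∀ (w : List ℕ) →
        suc (length w) ℕ.+ 2 ℕ.+ potential (T ∷ V) ℕ.≤ length w ℕ.+ 3 ℕ.+ potential (T ∷ V)
      one-more w =
        ℕ.≤-reflexive (cong (ℕ._+ potential (T ∷ V)) (sym (ℕ.+-suc (length w) 2)))
      charge-query : ∀ {r P} → Affordable (x ∷ A) 3 (T ∷ V) P r →
        Affordable (x ∷ A) 2 (T ∷ V) P (access T >> r)
      charge-query {just _ , w} (ensures ws (Pb , valid′ , h)) =
        ensures (gaps-length (x ∷ A) gaps T! ∷ ws) (Pb , valid′ , ℕ.≤-trans (one-more w) h)
      charge-query {nothing , w} (ensures ws h) =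
        ensures (gaps-length (x ∷ A) gaps T! ∷ ws) (ℕ.≤-trans (one-more w) h)

    -- The answer is abstracted together with its equation: a hit yields a stored `Gap`, a miss the
    -- freshness of the bound to be inserted.
    resume-affordable : ∀ {m S p v} x (A : Vec ℕ m) T (V : Collections m) → Valid (x ∷ A) (T ∷ V) →
      fromℕ (sum (x ∷ A)) ≤ S → ¬ fromℕ (sum (x ∷ A)) ≤ v → ¬ v ≤ 0ℚ →
      ∀ answer → find (contains? v) T ≡ answer →
      Affordable (x ∷ A) 3 (T ∷ V) (Bracket S p (x ∷ A) v) (resume S x A v T V answer)
    resume-affordable {S = S} {p} {v} x A T V valid@((gaps , T!) , _) Sₖ≤S Sₖ≰v v≰0 (just b) found =
      if-elim (Affordable (x ∷ A) 3 (T ∷ V) (Bracket S p (x ∷ A) v))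
        ((v ≟ bMAX b) ⊎-dec (v ≟ bMIN b))
        (λ _ → ensures [] (ℕ.+-mono-≤ (3≤budget _) (potential≤reserve (x ∷ A) (T ∷ V) valid)))
        (λ _ → let b∈ , v∈b = find-just (contains? v) T found in
          return-affordable ℕ.≤-refl valid (Gap⇒Bracket (ListAll.lookup gaps b∈) v∈b))
    resume-affordable {S = S} {p} {v} x A T V ((gaps , T!) , valid) Sₖ≤S Sₖ≰v v≰0 nothing missed =
      if-elim (Affordable (x ∷ A) 3 (T ∷ V) (Bracket S p (x ∷ A) v))
        (∣ ½ * fromℕ (sum (x ∷ A)) - (v - a) ∣ >? ∣ ½ * fromℕ (sum (x ∷ A)) - v ∣)
        (λ _ → call-pair x A gaps T! {V = V} (λ c b → join (shift a b) c) (λ C B → joined B C)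
          (call₀ V valid) call₁)
        (λ _ → call-pair x A gaps T! {V = V} (λ b c → join (shift a b) c) joined
          (call₁ V valid) call₀)
      where
      a = fromℕ x
      Sₖ₊₁≤S : fromℕ (sum A) ≤ S
      Sₖ₊₁≤S = ≤-trans (fromℕ-mono-≤ (ℕ.m≤n+m (sum A) x)) Sₖ≤S
      v≤S : v ≤ S
      v≤S = ≤-trans (<⇒≤ (≰⇒> Sₖ≰v)) Sₖ≤S
      0≤v : 0ℚ ≤ v
      0≤v = <⇒≤ (≰⇒> v≰0)
      -a≤0 : - a ≤ 0ℚ
      -a≤0 = neg-antimono-≤ (0≤fromℕ x)
      call₀ : ∀ V → Valid A V → Affordable A 2 V (Bracket S a A v) (setSum S a A v V)
      call₀ V valid = setSum-affordable A V valid Sₖ₊₁≤S v≤S (≤-trans -a≤0 0≤v)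
      -- Since `0 ≤ v`, the reduced capacity `v - a` does not fall below `- a`, the sentinel of the
      -- next level.
      call₁ : ∀ V → Valid A V → Affordable A 2 V (Bracket S a A (v - a)) (setSum S a A (v - a) V)
      call₁ V valid = setSum-affordable A V valid Sₖ₊₁≤S
        (≤-trans (+-monoʳ-≤ v -a≤0) (≤-trans (≤-reflexive (+-identityʳ v)) v≤S))
        (≤-trans (≤-reflexive (sym (+-identityˡ (- a)))) (+-monoˡ-≤ (- a) 0≤v))
      joined : ∀ {b c} → Bracket S a A (v - a) b → Bracket S a A v c →
        Gap (x ∷ A) (join (shift a b) c) × ListAll (join (shift a b) c ≢_) T ×
        Bracket S p (x ∷ A) v (join (shift a b) c)
      joined B C =
        let gap , v∈ = join-gap x A Sₖ≰v v≰0 Sₖ≤S B C in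
          gap
        -- After a miss no stored bound contains `v`, whereas the joined one does.
        , ListAll.map (λ v∉c eq → v∉c (subst (Contains v) eq v∈))
            (find-nothing (contains? v) T missed)
        , Gap⇒Bracket gap v∈

-- Balancing the two halves

module _ (h : ℕ) where

  -- Constant for up to `h` remaining elements, where insertions pay for the calls at rate 3;
  -- doubling with each element beyond, where two budgets below add up to exactly the one above and
  -- the rate is 0.
  halfBudget : ℕ → ℕ
  halfBudget m = 3 ℕ.* 2 ℕ.^ (m ℕ.∸ h)

  3≤halfBudget : ∀ m → 3 ℕ.≤ halfBudget m
  3≤halfBudget m = ℕ.m≤m*n 3 (2 ℕ.^ (m ℕ.∸ h)) {{ℕ.m^n≢0 2 (m ℕ.∸ h)}}

  open Amortised halfBudget 3≤halfBudget

  rate-below : ∀ {m} → suc m ℕ.≤ h → rate m ≡ 3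
  rate-below {m} m<h rewrite ℕ.m≤n⇒m∸n≡0 m<h | ℕ.m≤n⇒m∸n≡0 (ℕ.<⇒≤ m<h) = refl

  rate-above : ∀ i → rate (i ℕ.+ h) ≡ 0
  rate-above i rewrite ℕ.m+n∸n≡m i h | ℕ.m+n∸n≡m (suc i) h =
    ℕ.m≤n⇒m∸n≡0 (ℕ.≤-reflexive (double (2 ℕ.^ i)))
    where
    open +-*-Solver
    double : ∀ k → 2 ℕ.* (3 ℕ.* k) ≡ 3 ℕ.* (2 ℕ.* k)
    double = solve 1 (λ k → con 2 :* (con 3 :* k) := con 3 :* (con 2 :* k)) refl

  -- With `k = 2 ^ m` the next level adds `3 + 12 * k`. A constant `C` passes the induction step for
  -- all `k ≥ 1` when `3 + 12 + C ≤ 2 * C`, hence 15.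
  reserve-below : ∀ m → m ℕ.≤ h → reserve m ℕ.≤ 15 ℕ.* 2 ℕ.^ m
  reserve-below zero    _   = ℕ.z≤n
  reserve-below (suc m) m<h = begin
    rate m ℕ.* suc 4k ℕ.+ reserve m      ≡⟨ cong (λ r → r ℕ.* suc 4k ℕ.+ reserve m) (rate-below m<h) ⟩
    3 ℕ.* suc 4k ℕ.+ reserve m           ≤⟨ ℕ.+-monoʳ-≤ _ (reserve-below m (ℕ.<⇒≤ m<h)) ⟩
    3 ℕ.* suc 4k ℕ.+ 15 ℕ.* k            ≡⟨ collect k ⟩
    3 ℕ.+ 27 ℕ.* k                       ≤⟨ ℕ.+-monoˡ-≤ (27 ℕ.* k) (ℕ.m≤m*n 3 k {{ℕ.m^n≢0 2 m}}) ⟩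
    3 ℕ.* k ℕ.+ 27 ℕ.* k                 ≡⟨ collect′ k ⟩
    15 ℕ.* (2 ℕ.* k)                     ∎
    where
    open ℕ.≤-Reasoning
    open +-*-Solver
    k = 2 ℕ.^ m
    4k = 2 ℕ.* (2 ℕ.* k)
    collect : ∀ k → 3 ℕ.* suc (2 ℕ.* (2 ℕ.* k)) ℕ.+ 15 ℕ.* k ≡ 3 ℕ.+ 27 ℕ.* k
    collect = solve 1 (λ k →
      con 3 :* (con 1 :+ con 2 :* (con 2 :* k)) :+ con 15 :* k := con 3 :+ con 27 :* k) refl
    collect′ : ∀ k → 3 ℕ.* k ℕ.+ 27 ℕ.* k ≡ 15 ℕ.* (2 ℕ.* k)
    collect′ = solve 1 (λ k → con 3 :* k :+ con 27 :* k := con 15 :* (con 2 :* k)) refl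

  reserve-bound : ∀ i → reserve (i ℕ.+ h) ℕ.≤ 15 ℕ.* 2 ℕ.^ h
  reserve-bound zero    = reserve-below h ℕ.≤-refl
  reserve-bound (suc i) rewrite rate-above i = reserve-bound i

  access-bounds : ∀ i (A : Vec ℕ (i ℕ.+ h)) {E} → 0ℚ ≤ E → E ≤ fromℕ (sum A) →
    ListAll (ℕ._≤ 2 ℕ.^ suc (i ℕ.+ h)) (accessSizes A E) ×
    length (accessSizes A E) ℕ.≤ 3 ℕ.* 2 ℕ.^ i ℕ.+ 15 ℕ.* 2 ℕ.^ h
  access-bounds i A {E} 0≤E E≤S =
      Ensures.sizes affordable
    , ℕ.≤-trans (affordable-length {V = Vec.replicate _ []} (enumPlus A E) affordable)
        (ℕ.+-mono-≤ (ℕ.≤-reflexive (cong (λ j → 3 ℕ.* 2 ℕ.^ j) (ℕ.m+n∸n≡m i h))) (reserve-bound i))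
    where
    affordable : Affordable A 2 (Vec.replicate _ []) (Bracket (fromℕ (sum A)) 0ℚ A E) (enumPlus A E)
    affordable = setSum-affordable {p = 0ℚ} A (Vec.replicate _ []) (empty-valid A) ≤-refl E≤S 0≤E

-- Logarithmic cost of the operations

product-bound : ∀ {k} {w : List ℕ} → ListAll (ℕ._≤ 2 ℕ.^ suc k) w →
  product (List.map (2 ℕ.⊔_) w) ℕ.≤ 2 ℕ.^ (suc k ℕ.* length w)
product-bound {k} [] = ℕ.m^n>0 2 (k ℕ.* 0)
product-bound {k} {s ∷ w} (s≤ ∷ ws) = begin
  (2 ℕ.⊔ s) ℕ.* product (List.map (2 ℕ.⊔_) w)     ≤⟨ ℕ.*-mono-≤ (ℕ.⊔-lub 2≤ s≤) (product-bound {k} ws) ⟩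
  2 ℕ.^ suc k ℕ.* 2 ℕ.^ (suc k ℕ.* length w)      ≡⟨ ℕ.^-distribˡ-+-* 2 (suc k) (suc k ℕ.* length w) ⟨
  2 ℕ.^ (suc k ℕ.+ suc k ℕ.* length w)            ≡⟨ cong (2 ℕ.^_) (ℕ.*-suc (suc k) (length w)) ⟨
  2 ℕ.^ (suc k ℕ.* suc (length w))                ∎
  where
  open ℕ.≤-Reasoning
  2≤ : 2 ℕ.≤ 2 ℕ.^ suc k
  2≤ = ℕ.m≤m*n 2 (2 ℕ.^ k) {{ℕ.m^n≢0 2 k}}

2^-cancel-≤ : ∀ {m n} → 2 ℕ.^ m ℕ.≤ 2 ℕ.^ n → m ℕ.≤ n
2^-cancel-≤ {m} {n} 2^m≤2^n = ℕ.≮⇒≥ λ n<m → ℕ.<⇒≱ (ℕ.^-monoʳ-< 2 ℕ.≤-refl n<m) 2^m≤2^n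

-- For `q = p / d`, comparing exponents in `2 ^ p ≤ N ^ d ≤ 2 ^ (k * d)` gives `p ≤ k * d`; negative
-- `q` lie below `k` anyway.
log₂-bound : ∀ {N k} → N ℕ.≤ 2 ℕ.^ k → ∀ q → log₂ N q → q ≤ fromℕ k
log₂-bound {N} {k} N≤ q@(mkℚ (ℤ.+ p) d-1 _) 2^p≤ = toℚᵘ-cancel-≤ (ℚᵘ.≤-trans
  (ℚᵘ.*≤* (subst₂ ℤ._≤_ (sym (ℤ.*-identityʳ (ℤ.+ p))) (ℤ.pos-* k (suc d-1)) (ℤ.+≤+ p≤)))
  (ℚᵘ.≤-reflexive (ℚᵘ.≃-sym (toℚᵘ-fromℕ k))))
  where
  open ℕ.≤-Reasoning
  p≤ : p ℕ.≤ k ℕ.* suc d-1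
  p≤ = 2^-cancel-≤ (begin
    2 ℕ.^ p                  ≤⟨ 2^p≤ ⟩
    N ℕ.^ suc d-1            ≤⟨ ℕ.^-monoˡ-≤ (suc d-1) N≤ ⟩
    (2 ℕ.^ k) ℕ.^ suc d-1    ≡⟨ ℕ.^-*-assoc 2 k (suc d-1) ⟩
    2 ℕ.^ (k ℕ.* suc d-1)    ∎)
log₂-bound {k = k} _ q@(mkℚ ℤ.-[1+ _ ] _ _) _ = ≤-trans (<⇒≤ (negative⁻¹ q)) (0≤fromℕ k)

-- Comparison with the surd bound

*-square-mono-≤ : ∀ {p q} → 0ℚ ≤ p → p ≤ q → p * p ≤ q * q
*-square-mono-≤ {p} {q} 0≤p p≤q = ≤-trans
  (*-monoˡ-≤-nonNeg p {{nonNegative 0≤p}} p≤q)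
  (*-monoʳ-≤-nonNeg q {{nonNegative (≤-trans 0≤p p≤q)}} p≤q)

-- As `c` is at most the square root of `m`, it can replace the root in a lower estimate. For
-- negative `a`, squaring `- a ≤ b * c` gives the third alternative of `NonNeg`.
surd-nonNeg : ∀ {m a b c} → 0ℚ ≤ b → c * c ≤ fromℕ m → - a ≤ b * c → NonNeg {m} (surd a b)
surd-nonNeg {m} {a} {b} {c} 0≤b c²≤m -a≤bc with ≤-total 0ℚ a
... | inj₁ 0≤a = inj₁ (0≤a , 0≤b)
... | inj₂ a≤0 = inj₂ (inj₂ (0≤b , (begin
  a * a                ≡⟨ neg² a ⟩
  - a * - a            ≤⟨ *-square-mono-≤ (neg-antimono-≤ a≤0) -a≤bc ⟩
  (b * c) * (b * c)    ≡⟨ regroup b c ⟩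
  b * b * (c * c)      ≤⟨ *-monoˡ-≤-nonNeg (b * b) {{nonNeg*nonNeg⇒nonNeg b b}} c²≤m ⟩
  b * b * fromℕ m      ∎)))
  where
  open ≤-Reasoning
  open ℚ.+-*-Solver
  instance
    _ = nonNegative 0≤b
  neg² : ∀ a → a * a ≡ - a * - a
  neg² = solve 1 (λ a → a :* a := :- a :* :- a) refl
  regroup : ∀ b c → (b * c) * (b * c) ≡ b * b * (c * c)
  regroup = solve 2 (λ b c → (b :* c) :* (b :* c) := b :* b :* (c :* c)) refl


-- The lower part gets the larger half of the levels. For odd `n` this doubles its share relative to
-- `2 ^ ⌊ n /2⌋`, whence `33 = 3 + 2 * 15`.
half-bounds : ∀ n (A : Vec ℕ n) {E} → 0ℚ ≤ E → E ≤ fromℕ (sum A) →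
  ListAll (ℕ._≤ 2 ℕ.^ suc n) (accessSizes A E) ×
  length (accessSizes A E) ℕ.≤ 33 ℕ.* 2 ℕ.^ ⌊ n /2⌋
half-bounds n A 0≤E E≤S = bounds (ℕ.⌊n/2⌋+⌈n/2⌉≡n n) A 0≤E E≤S
  where
  open ℕ.≤-Reasoning
  open +-*-Solver
  i = ⌊ n /2⌋
  h = ⌈ n /2⌉
  h≤1+i : ∀ n → ⌈ n /2⌉ ℕ.≤ suc ⌊ n /2⌋
  h≤1+i zero          = ℕ.z≤n
  h≤1+i (suc zero)    = ℕ.≤-refl
  h≤1+i (suc (suc n)) = ℕ.s≤s (h≤1+i n)
  lower : 15 ℕ.* 2 ℕ.^ h ℕ.≤ 15 ℕ.* 2 ℕ.^ suc i
  lower = ℕ.*-monoʳ-≤ 15 (ℕ.^-monoʳ-≤ 2 (h≤1+i n))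
  collect : ∀ k → 3 ℕ.* k ℕ.+ 15 ℕ.* (2 ℕ.* k) ≡ 33 ℕ.* k
  collect = solve 1 (λ k → con 3 :* k :+ con 15 :* (con 2 :* k) := con 33 :* k) refl
  -- The length is generalised with `i` and `h` fixed, so that the equation can be matched against
  -- `refl`.
  bounds : ∀ {n} → i ℕ.+ h ≡ n → (A : Vec ℕ n) → ∀ {E} → 0ℚ ≤ E → E ≤ fromℕ (sum A) →
    ListAll (ℕ._≤ 2 ℕ.^ suc n) (accessSizes A E) × length (accessSizes A E) ℕ.≤ 33 ℕ.* 2 ℕ.^ i
  bounds refl A {E} 0≤E E≤S =
    let sizes , count = access-bounds h i A 0≤E E≤S in
    sizes , (begin
      length (accessSizes A E)                ≤⟨ count ⟩
      3 ℕ.* 2 ℕ.^ i ℕ.+ 15 ℕ.* 2 ℕ.^ h        ≤⟨ ℕ.+-monoʳ-≤ (3 ℕ.* 2 ℕ.^ i) lower ⟩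
      3 ℕ.* 2 ℕ.^ i ℕ.+ 15 ℕ.* 2 ℕ.^ suc i    ≡⟨ collect (2 ℕ.^ i) ⟩
      33 ℕ.* 2 ℕ.^ i                          ∎)

-- Provides the rational lower estimate of `2^{n/2}` that `surd-nonNeg` takes as `c`.
2^half-square : ∀ n → fromℕ (2 ℕ.^ ⌊ n /2⌋) * fromℕ (2 ℕ.^ ⌊ n /2⌋) ≤ fromℕ (2 ℕ.^ n)
2^half-square n = begin
  fromℕ (2 ℕ.^ i) * fromℕ (2 ℕ.^ i)    ≡⟨ fromℕ-homo-* (2 ℕ.^ i) (2 ℕ.^ i) ⟨
  fromℕ (2 ℕ.^ i ℕ.* 2 ℕ.^ i)          ≡⟨ cong fromℕ (ℕ.^-distribˡ-+-* 2 i i) ⟨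
  fromℕ (2 ℕ.^ (i ℕ.+ i))              ≤⟨ fromℕ-mono-≤ (ℕ.^-monoʳ-≤ 2 i+i≤n) ⟩
  fromℕ (2 ℕ.^ n)                      ∎
  where
  open ≤-Reasoning
  i = ⌊ n /2⌋
  i+i≤n : i ℕ.+ i ℕ.≤ n
  i+i≤n = ℕ.≤-trans (ℕ.+-monoʳ-≤ i (ℕ.⌊n/2⌋≤⌈n/2⌉ n)) (ℕ.≤-reflexive (ℕ.⌊n/2⌋+⌈n/2⌉≡n n))

½-bounds : ∀ {S} → 0ℚ ≤ S → 0ℚ ≤ ½ * S × ½ * S ≤ S
½-bounds {S} 0≤S =
    ≤-trans (≤-reflexive (sym (*-zeroʳ ½))) (*-monoˡ-≤-nonNeg ½ 0≤S)
  , ≤-trans (*-monoʳ-≤-nonNeg S {{nonNegative 0≤S}} (<⇒≤ ½<1)) (≤-reflexive (*-identityˡ S))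
  where
  ½<1 : ½ < 1ℚ
  ½<1 = *<* (ℤ.+<+ ℕ.≤-refl)

proposition3 : ∃[ c ] (0ℚ < c) ×
    (∃[ C ] (0ℚ < C) × (∃[ n₀ ]
    (∀ n → n₀ ℕ.≤ n → (A : Vec ℕ n) → Linked ℕ._>_ A → All (0 ℕ.<_) A →
    time A (½ * fromℕ (sum A)) ≤ᶜ cut (C ⊙ bound c n))))
-- With `c = 1` the factor of `2^{n/2}` is `n - 1`. The time is at most
-- `33 * (n + 1) * 2 ^ ⌊ n /2⌋`, and `33 * (n + 1) ≤ 99 * (n - 1)` holds from `n = 2` on.
proposition3 = 1ℚ , positive⁻¹ 1ℚ , fromℕ 99 , positive⁻¹ (fromℕ 99) , 2 , below
  where
  below : ∀ n → 2 ℕ.≤ n → (A : Vec ℕ n) → Linked ℕ._>_ A → All (0 ℕ.<_) A →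
    time A (½ * fromℕ (sum A)) ≤ᶜ cut (fromℕ 99 ⊙ bound 1ℚ n)
  below n@(suc (suc k)) (ℕ.s≤s (ℕ.s≤s _)) A _ _ q q≤time =
    surd-nonNeg {2 ℕ.^ n} {c = fromℕ h} 0≤β (2^half-square n) -α≤βh
    where
    h : ℕ
    h = 2 ℕ.^ ⌊ n /2⌋
    -- The rational and the irrational part of `fromℕ 99 ⊙ bound 1ℚ n ⊖ ι q`, in the form to which
    -- they compute.
    α β : ℚ
    α = fromℕ 99 * (fromℕ n * 0ℚ - 1ℚ * 0ℚ + fromℕ n) - q
    β = fromℕ 99 * (fromℕ n * 1ℚ - 1ℚ * 1ℚ + 0ℚ) - 0ℚ

    simplify-β : ∀ C p → C * ((1ℚ + p) * 1ℚ - 1ℚ * 1ℚ + 0ℚ) - 0ℚ ≡ C * p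
    simplify-β = solve 2 (λ C p →
      C :* ((con 1ℚ :+ p) :* con 1ℚ :- con 1ℚ :* con 1ℚ :+ con 0ℚ) :- con 0ℚ := C :* p) refl
      where open ℚ.+-*-Solver
    β≡ : β ≡ fromℕ (99 ℕ.* suc k)
    β≡ = trans (cong (λ N → fromℕ 99 * (N * 1ℚ - 1ℚ * 1ℚ + 0ℚ) - 0ℚ) (fromℕ-homo-+ 1 (suc k)))
           (trans (simplify-β (fromℕ 99) (fromℕ (suc k))) (sym (fromℕ-homo-* 99 (suc k))))
    0≤β : 0ℚ ≤ β
    0≤β = subst (0ℚ ≤_) (sym β≡) (0≤fromℕ (99 ℕ.* suc k))

    negate-α : ∀ C N q → - (C * (N * 0ℚ - 1ℚ * 0ℚ + N) - q) ≡ q - C * N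
    negate-α = solve 3 (λ C N q →
      :- (C :* (N :* con 0ℚ :- con 1ℚ :* con 0ℚ :+ N) :- q) := q :- C :* N) refl
      where open ℚ.+-*-Solver

    count : product (List.map (2 ℕ.⊔_) (accessSizes A (½ * fromℕ (sum A)))) ℕ.≤
            2 ℕ.^ (suc n ℕ.* (33 ℕ.* h))
    count =
      let 0≤E , E≤S     = ½-bounds (0≤fromℕ (sum A))
          sizes , number = half-bounds n A 0≤E E≤S
      in ℕ.≤-trans (product-bound {n} sizes)
           (ℕ.^-monoʳ-≤ 2 (ℕ.*-monoʳ-≤ (suc n) number))

    -- n + 1 ≤ 3 (n - 1), where n - 1 is suc k
    1+n≤ : suc n ℕ.* (33 ℕ.* h) ℕ.≤ 99 ℕ.* suc k ℕ.* h
    1+n≤ = ℕ.≤-trans (ℕ.*-monoˡ-≤ (33 ℕ.* h) 3+k≤) (ℕ.≤-reflexive (regroup k h))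
      where
      open +-*-Solver
      3+k≤ : 3 ℕ.+ k ℕ.≤ 3 ℕ.* suc k
      3+k≤ = ℕ.≤-trans (ℕ.+-monoʳ-≤ 3 (ℕ.m≤n*m k 3)) (ℕ.≤-reflexive (sym (ℕ.*-suc 3 k)))
      regroup : ∀ k h → 3 ℕ.* suc k ℕ.* (33 ℕ.* h) ≡ 99 ℕ.* suc k ℕ.* h
      regroup = solve 2 (λ k h →
        con 3 :* (con 1 :+ k) :* (con 33 :* h) := con 99 :* (con 1 :+ k) :* h) refl

    open ≤-Reasoning
    -α≤βh : - α ≤ β * fromℕ h
    -α≤βh = begin
      - α                               ≡⟨ negate-α (fromℕ 99) (fromℕ n) q ⟩
      q - fromℕ 99 * fromℕ n            ≡⟨ cong (λ N → q - N) (fromℕ-homo-* 99 n) ⟨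
      q - fromℕ (99 ℕ.* n)              ≤⟨ +-monoʳ-≤ q (neg-antimono-≤ (0≤fromℕ (99 ℕ.* n))) ⟩
      q + 0ℚ                            ≡⟨ +-identityʳ q ⟩
      q                                 ≤⟨ log₂-bound {k = suc n ℕ.* (33 ℕ.* h)} count q q≤time ⟩
      fromℕ (suc n ℕ.* (33 ℕ.* h))      ≤⟨ fromℕ-mono-≤ 1+n≤ ⟩
      fromℕ (99 ℕ.* suc k ℕ.* h)        ≡⟨ fromℕ-homo-* (99 ℕ.* suc k) h ⟩
      fromℕ (99 ℕ.* suc k) * fromℕ h    ≡⟨ cong (_* fromℕ h) β≡ ⟨
      β * fromℕ h                       ∎
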